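{- Let $w$ be a double occurrence word over the alphabet $\Sigma=\{1,2,\dots,n\}$ with $|w|=2n$. Then the following are equivalent: (1) for every proper non-empty subset $\sigma\subset\Sigma$, at least one word in $w\setminus\sigma$ has odd length; (2) $w=w_{TC_n}$ up to renaming of the letters.
   Context: A double occurrence word is a non-empty word in which each letter of the alphabet occurs exactly twice or not at all. For a word $w$ and a non-empty set of letters $\sigma$, $w\setminus\sigma$ denotes the sequence of non-empty subwords obtained from $w$ by deleting all occurrences of letters of $\sigma$ (i.e. the maximal contiguous blocks of $w$ containing no letter of $\sigma$). The tangled cord word is $w_{TC_n}=1\,2\,1\,3\,2\,4\,3\dots n\,(n-1)\,n$ (e.g. $w_{TC_1}=11$, $w_{TC_2}=1212$, $w_{TC_3}=121323$, $w_{TC_4}=12132434$). -}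

module Defs where

open import Data.Nat using (ℕ; zero; suc; _*_; _%_)
open import Data.Fin using (Fin; toℕ; _≟_)
open import Data.Fin.Subset using (Subset; _∈_)
open import Data.Fin.Subset.Properties using (_∈?_)
open import Data.Fin.Permutation using (Permutation′; _⟨$⟩ʳ_)
open import Data.List using (List; []; _∷_; _++_; length; filter; map; concatMap; upTo)
open import Data.List.Relation.Unary.All using (All)
open import Data.Product using (_×_; _,_; ∃)
open import Data.Bool using (if_then_else_)
open import Relation.Nullary using (does)
open import Relation.Binary.PropositionalEquality using (_≡_)

occ : ∀ {n} → Fin n → List (Fin n) → ℕ
occ a w = length (filter (a ≟_) w)

-- double occurrence word over the alphabet Fin n (letters 0..n-1 stand for 1..n):
-- non-empty, and each letter occurs exactly twice or not at all
DoubleOccurrence : ∀ {n} → List (Fin n) → Set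
DoubleOccurrence {n} w = (∃ λ x → ∃ λ xs → w ≡ x ∷ xs) × (∀ a → occ a w ≡ 0 ⊎′ occ a w ≡ 2)
  where
  open import Data.Sum using () renaming (_⊎_ to _⊎′_)

consBlock : ∀ {A : Set} → List A → List (List A) → List (List A)
consBlock []       bs = bs
consBlock (x ∷ xs) bs = (x ∷ xs) ∷ bs

-- (current leading block, remaining maximal blocks)
splitAux : ∀ {n} → Subset n → List (Fin n) → List (Fin n) × List (List (Fin n))
splitAux σ [] = [] , []
splitAux σ (x ∷ xs) with splitAux σ xs
... | cur , bs = if does (x ∈? σ) then ([] , consBlock cur bs) else (x ∷ cur , bs)

_∖_ : ∀ {n} → List (Fin n) → Subset n → List (List (Fin n))
w ∖ σ with splitAux σ w
... | cur , bs = consBlock cur bs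

OddLength : ∀ {A : Set} → List A → Set
OddLength xs = length xs % 2 ≡ 1

-- tangled cord word w_TC_(m+1), 0-indexed letters as naturals:
-- 0 1 0 2 1 3 2 ... m (m-1) m
tcℕ : ℕ → List ℕ
tcℕ m = 0 ∷ concatMap (λ k → suc k ∷ k ∷ []) (upTo m) ++ m ∷ []

IsTCUpToRenaming : ∀ {n} → List (Fin (suc n)) → Set
IsTCUpToRenaming {n} w = ∃ λ (π : Permutation′ (suc n)) → map (λ x → toℕ (π ⟨$⟩ʳ x)) w ≡ tcℕ n

{-# OPTIONS --safe #-}

-- Contraction: deleting two adjacent distinct letters a b from w and identifying
-- the two remaining occurrences of a and b preserves condition (1), because a set
-- of letters with even blocks in the contracted word lifts to w.  Contracting the
-- first two letters, induction makes the contracted word a tangled cord, so w is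
-- a b followed by a tangled cord in which the two occurrences of one letter k are
-- replaced by a and b in some order.  If the order is b … a, then deleting a and
-- all letters above k leaves a single even block; if it is a … b and k is not the
-- first letter, then deleting a alone leaves even blocks.  The only remaining word
-- is the tangled cord.  Conversely, reading the tangled cord from the left with
-- all blocks even forces every letter to be treated like the first one.
module Submission where

open import Defs
open import Data.Nat using (ℕ; suc; _*_)
open import Data.Fin using (Fin)
open import Data.Fin.Subset using (Subset; ⊤; _⊂_; Nonempty)
open import Data.List using (List; length)
open import Data.List.Relation.Unary.Any using (Any)
open import Function.Bundles using (_⇔_)
open import Relation.Binary.PropositionalEquality using (_≡_)

open import Data.Bool using (Bool; true; false; not; _∧_; _∨_; if_then_else_)
open import Data.Bool.Properties using (not-involutive; ∨-zeroʳ; ¬-not)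
open import Data.Fin using (toℕ; fromℕ<; _≟_; punchOut)
import Data.Fin.Properties as Finₚ
open import Data.Fin.Permutation using (permutation; _⟨$⟩ʳ_; _⟨$⟩ˡ_; inverseˡ)
open import Data.Fin.Subset.Properties using (_∈?_; ∈⊤)
open import Data.List using ([]; _∷_; _++_; map; concatMap; applyUpTo)
open import Data.List.Properties using (map-∘; map-cong; map-cong-local; length-map; filter-accept; filter-reject; ∷-injectiveˡ; ∷-injectiveʳ)
open import Data.List.Membership.Propositional using (_∈_; _∉_)
open import Data.List.Membership.Propositional.Properties using (∈-map⁺; ∈-map⁻; ∈-++⁺ʳ)
open import Data.List.Relation.Unary.All as All using (All; []; _∷_)
open import Data.List.Relation.Unary.All.Properties using (++⁺; map⁻)
open import Data.List.Relation.Unary.Any using (here; there)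
open import Data.Nat using (zero; _+_; _≤_; _<_; z≤n; s≤s; _<?_)
import Data.Nat as ℕ
open import Data.Nat.Properties using (≤-refl; ≤-trans; ≤-reflexive; <-irrefl; m≤m+n; m≤n⇒m≤1+n; n<1+n; +-suc; +-identityʳ; *-suc; suc-injective; ≤∧≢⇒<; <-asym; <⇒≤)
open import Data.Product using (_×_; _,_; ∃; ∃₂; proj₁; proj₂)
open import Data.Sum using (_⊎_; inj₁; inj₂)
open import Data.Vec using (tabulate)
open import Data.Vec.Properties using (lookup∘tabulate; []=⇒lookup; lookup⇒[]=)
open import Function using (_∘_; id; const)
open import Function.Bundles using (mk⇔)
open import Relation.Binary.PropositionalEquality using (refl; sym; trans; cong; cong₂; subst; _≢_; module ≡-Reasoning)
open import Relation.Nullary using (¬_; Dec; does; yes; no; contradiction)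
open import Relation.Nullary.Decidable using (dec-true; dec-false)

private
  variable
    A C : Set
    n : ℕ

-- Parity of lengths and of runs

toggle : Bool → List A → Bool
toggle b []       = b
toggle b (_ ∷ xs) = toggle (not b) xs

toggle-map : ∀ (f : A → C) b xs → toggle b (map f xs) ≡ toggle b xs
toggle-map f b []       = refl
toggle-map f b (x ∷ xs) = toggle-map f (not b) xs

-- Whether all maximal runs of letters outside p have even length; the flag b
-- says that the run being read already has an odd number of letters.
evenRuns : Bool → (A → Bool) → List A → Bool
evenRuns b p []       = not b
evenRuns b p (x ∷ xs) = if p x then not b ∧ evenRuns false p xs else evenRuns (not b) p xs

evenRuns-cong : ∀ {p q : A → Bool} → (∀ x → p x ≡ q x) → ∀ b w → evenRuns b p w ≡ evenRuns b q w
evenRuns-cong p≗q b []      = refl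
evenRuns-cong {q = q} p≗q b (x ∷ w) rewrite p≗q x with q x
... | true  = cong (not b ∧_) (evenRuns-cong p≗q false w)
... | false = evenRuns-cong p≗q (not b) w

evenRuns-map : ∀ (h : A → C) p b w → evenRuns b p (map h w) ≡ evenRuns b (p ∘ h) w
evenRuns-map h p b []      = refl
evenRuns-map h p b (x ∷ w) with p (h x)
... | true  = cong (not b ∧_) (evenRuns-map h p false w)
... | false = evenRuns-map h p (not b) w

evenRuns-∷-in : ∀ (p : A → Bool) x xs → p x ≡ true → evenRuns false p (x ∷ xs) ≡ evenRuns false p xs
evenRuns-∷-in p x xs px rewrite px = refl

evenRuns-++-out : ∀ (p : A → Bool) b xs {ys} → All (λ x → p x ≡ false) xs →
  evenRuns b p (xs ++ ys) ≡ evenRuns (toggle b xs) p ys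
evenRuns-++-out p b []       []         = refl
evenRuns-++-out p b (x ∷ xs) (px ∷ pxs) rewrite px = evenRuns-++-out p (not b) xs pxs

evenRuns-out : ∀ (p : A → Bool) b {xs} → All (λ x → p x ≡ false) xs →
  evenRuns b p xs ≡ not (toggle b xs)
evenRuns-out p b []         = refl
evenRuns-out p b (px ∷ pxs) rewrite px = evenRuns-out p (not b) pxs

evenRuns-in : ∀ (p : A → Bool) {xs} → All (λ x → p x ≡ true) xs → evenRuns false p xs ≡ true
evenRuns-in p []         = refl
evenRuns-in p (px ∷ pxs) rewrite px = evenRuns-in p pxs

-- Blocks of w ∖ σ

allEven : List (List A) → Bool
allEven []       = true
allEven (b ∷ bs) = not (toggle false b) ∧ allEven bs

allEven-consBlock : ∀ (b : List A) bs → allEven (consBlock b bs) ≡ not (toggle false b) ∧ allEven bs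
allEven-consBlock []      bs = refl
allEven-consBlock (x ∷ b) bs = refl

-- `splitAux` keeps its unfinished leading block apart, and that block is the run which the flag `b`
-- prolongs. The next letter either closes this run or flips the flag, so the induction needs all
-- values of `b`.
evenRuns-splitAux : ∀ (σ : Subset n) b w →
  evenRuns b (λ x → does (x ∈? σ)) w ≡ not (toggle b (proj₁ (splitAux σ w))) ∧ allEven (proj₂ (splitAux σ w))
evenRuns-splitAux σ false [] = refl
evenRuns-splitAux σ true  [] = refl
evenRuns-splitAux σ b (x ∷ w) with splitAux σ w | evenRuns-splitAux σ false w | evenRuns-splitAux σ (not b) w | does (x ∈? σ)
... | cur , bs | ih | _ | true  = cong (not b ∧_) (trans ih (sym (allEven-consBlock cur bs)))
... | cur , bs | _ | ih | false = ih

evenRuns-∖ : ∀ (σ : Subset n) w → evenRuns false (λ x → does (x ∈? σ)) w ≡ allEven (w ∖ σ)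
evenRuns-∖ σ w with splitAux σ w | evenRuns-splitAux σ false w
... | cur , bs | eq = trans eq (sym (allEven-consBlock cur bs))

odd⇒toggle : ∀ (xs : List A) → OddLength xs → toggle false xs ≡ true
odd⇒toggle (_ ∷ [])     _   = refl
odd⇒toggle (_ ∷ _ ∷ xs) odd = odd⇒toggle xs odd

toggle⇒odd : ∀ (xs : List A) → toggle false xs ≡ true → OddLength xs
toggle⇒odd (_ ∷ [])     _   = refl
toggle⇒odd (_ ∷ _ ∷ xs) odd = toggle⇒odd xs odd

anyOdd⇒¬allEven : ∀ {bs : List (List A)} → Any OddLength bs → allEven bs ≡ false
anyOdd⇒¬allEven {bs = b ∷ _} (here odd) rewrite odd⇒toggle b odd = refl
anyOdd⇒¬allEven {bs = b ∷ _} (there odds) with toggle false b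
... | true  = refl
... | false = anyOdd⇒¬allEven odds

¬allEven⇒anyOdd : ∀ (bs : List (List A)) → allEven bs ≡ false → Any OddLength bs
¬allEven⇒anyOdd (b ∷ bs) eq with toggle false b in odd
... | true  = here (toggle⇒odd b odd)
... | false = there (¬allEven⇒anyOdd bs eq)

does-∈?-tabulate : ∀ (p : Fin n → Bool) x → does (x ∈? tabulate p) ≡ p x
does-∈?-tabulate p x with p x in px
... | true  = dec-true (x ∈? tabulate p) (lookup⇒[]= x (tabulate p) (trans (lookup∘tabulate p x) px))
... | false = dec-false (x ∈? tabulate p) λ x∈ →
  contradiction (trans (sym ([]=⇒lookup x∈)) (trans (lookup∘tabulate p x) px)) λ ()

-- The negation of "even blocks" for all sets that split the letters of w,
-- independent of the ambient alphabet.
Indecomposable : List A → Set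
Indecomposable {A} w = ∀ (p : A → Bool) {x y} → x ∈ w → p x ≡ true → y ∈ w → p y ≡ false →
  evenRuns false p w ≢ true

-- The predicate `p` becomes the set `tabulate p`: `x` makes it non-empty and `y` makes it proper.
oddBlocks⇒indecomposable : ∀ {w : List (Fin n)} →
  (∀ σ → Nonempty σ → σ ⊂ ⊤ → Any OddLength (w ∖ σ)) → Indecomposable w
oddBlocks⇒indecomposable {w = w} odd p {x} {y} _ px _ py even =
  contradiction (trans (sym allEven≡true) (anyOdd⇒¬allEven (odd σ (x , x∈σ) ((λ _ → ∈⊤) , y , ∈⊤ , y∉σ)))) λ ()
  where
  σ = tabulate p
  x∈σ = lookup⇒[]= x σ (trans (lookup∘tabulate p x) px)
  y∉σ = λ y∈σ → contradiction (trans (sym ([]=⇒lookup y∈σ)) (trans (lookup∘tabulate p y) py)) λ ()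
  allEven≡true : allEven (w ∖ σ) ≡ true
  allEven≡true = trans (sym (evenRuns-∖ σ w)) (trans (evenRuns-cong (does-∈?-tabulate p) false w) even)

-- The tangled cord

-- tail k l = (k+1) k (k+2) (k+1) … (k+l) (k+l-1) (k+l)
tail : ℕ → ℕ → List ℕ
tail k zero    = k ∷ []
tail k (suc l) = suc k ∷ k ∷ tail (suc k) l

tc : ℕ → List ℕ
tc m = 0 ∷ tail 0 m

-- `upTo` unfolds through `applyUpTo`, whose function is composed with `suc` at each step. The
-- induction therefore runs over every `g` that is a shift by `s`.
tail-applyUpTo : ∀ (g : ℕ → ℕ) s l → (∀ i → g i ≡ s + i) →
  concatMap (λ k → suc k ∷ k ∷ []) (applyUpTo g l) ++ (s + l) ∷ [] ≡ tail s l
tail-applyUpTo g s zero    g≗ = cong (_∷ []) (+-identityʳ s)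
tail-applyUpTo g s (suc l) g≗ rewrite trans (g≗ 0) (+-identityʳ s) | +-suc s l =
  cong (λ t → suc s ∷ s ∷ t) (tail-applyUpTo (g ∘ suc) (suc s) l (λ i → trans (g≗ (suc i)) (+-suc s i)))

tcℕ≡tc : ∀ m → tcℕ m ≡ tc m
tcℕ≡tc m = cong (0 ∷_) (tail-applyUpTo id 0 m (λ _ → refl))

-- The length of `tail k l` is `2l + 1`.
toggle-tail : ∀ b k l → toggle b (tail k l) ≡ not b
toggle-tail b k zero    = refl
toggle-tail b k (suc l) rewrite not-involutive b = toggle-tail b (suc k) l

tail-≥ : ∀ k l → All (k ≤_) (tail k l)
tail-≥ k zero    = ≤-refl ∷ []
tail-≥ k (suc l) = <⇒≤ (n<1+n k) ∷ ≤-refl ∷ All.map (≤-trans (<⇒≤ (n<1+n k))) (tail-≥ (suc k) l)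

tail-≤ : ∀ k l → All (_≤ k + l) (tail k l)
tail-≤ k zero    = m≤m+n k 0 ∷ []
tail-≤ k (suc l) rewrite +-suc k l = s≤s (m≤m+n k l) ∷ m≤n⇒m≤1+n (m≤m+n k l) ∷ tail-≤ (suc k) l

tc-≤ : ∀ m → All (_≤ m) (tc m)
tc-≤ m = z≤n ∷ tail-≤ 0 m

∈-tail : ∀ s l {j} → s ≤ j → j ≤ s + l → j ∈ tail s l
∈-tail s l {j} s≤j j≤ with s ℕ.≟ j
... | yes refl = start s l
  where
  start : ∀ s l → s ∈ tail s l
  start s zero    = here refl
  start s (suc l) = there (here refl)
∈-tail s zero    s≤j j≤ | no s≢j = contradiction (≤-trans (≤∧≢⇒< s≤j s≢j) (≤-trans j≤ (≤-reflexive (+-identityʳ s)))) (<-irrefl refl)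
∈-tail s (suc l) s≤j j≤ | no s≢j = there (there (∈-tail (suc s) l (≤∧≢⇒< s≤j s≢j) (≤-trans j≤ (≤-reflexive (+-suc s l)))))

∈-tc : ∀ m {j} → j ≤ m → j ∈ tc m
∈-tc m j≤m = there (∈-tail 0 m z≤n j≤m)

-- If `suc k` were kept, it would be a run of one letter, closed at once by the deleted `k`. So
-- `suc k` is deleted too, and the argument repeats one letter higher.
tail-in : ∀ (p : ℕ → Bool) k l → p k ≡ true → evenRuns false p (tail k l) ≡ true → All (λ j → p j ≡ true) (tail k l)
tail-in p k zero    pk even = pk ∷ []
tail-in p k (suc l) pk even with p (suc k) in psk
... | true  rewrite pk = psk ∷ pk ∷ tail-in p (suc k) l psk even
... | false rewrite pk = contradiction even λ ()

-- An odd run may not end at `suc k`, so `suc k` is kept. Together with the kept `k` it lengthens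
-- the run by two, which leaves the run odd for the next step.
tail-out : ∀ (p : ℕ → Bool) k l → p k ≡ false → evenRuns true p (tail k l) ≡ true → All (λ j → p j ≡ false) (tail k l)
tail-out p k zero    pk even = pk ∷ []
tail-out p k (suc l) pk even with p (suc k) in psk
... | false rewrite pk = psk ∷ pk ∷ tail-out p (suc k) l psk even
... | true  = contradiction even λ ()

tc-indecomposable : ∀ m → Indecomposable (tc m)
tc-indecomposable m p x∈ px y∈ py even with p 0 in p0
... | true  = contradiction (trans (sym (All.lookup (p0 ∷ tail-in p 0 m p0 even) y∈)) py) λ ()
... | false = contradiction (trans (sym px) (All.lookup (p0 ∷ tail-out p 0 m p0 even) x∈)) λ ()

tail-split-start : ∀ k l → ∃₂ λ U V → tail k l ≡ U ++ k ∷ V × All (k <_) U × All (k <_) V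
tail-split-start k zero    = [] , [] , refl , [] , []
tail-split-start k (suc l) = suc k ∷ [] , tail (suc k) l , refl , n<1+n k ∷ [] , tail-≥ (suc k) l

-- Pairs `suc s ∷ s` are peeled off until one starts with `k`; `P` consists of whole pairs, hence
-- its even length.
tail-split-later : ∀ s l {k} → s < k → k ≤ s + l → ∃₂ λ P j → ∃ λ l′ →
  k ≡ suc j × tail s l ≡ P ++ suc j ∷ j ∷ tail (suc j) l′ × All (_< k) P × (∀ b → toggle b P ≡ b)
tail-split-later s zero    s<k k≤ = contradiction (≤-trans s<k (≤-trans k≤ (≤-reflexive (+-identityʳ s)))) (<-irrefl refl)
tail-split-later s (suc l) {k} s<k k≤ with suc s ℕ.≟ k
... | yes refl = [] , s , l , refl , refl , [] , λ _ → refl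
... | no ss≢k with tail-split-later (suc s) l (≤∧≢⇒< s<k ss≢k) (≤-trans k≤ (≤-reflexive (+-suc s l)))
...   | P , j , l′ , k≡ , eq , P<k , even =
  suc s ∷ s ∷ P , j , l′ , k≡ , cong (λ t → suc s ∷ s ∷ t) eq , ≤∧≢⇒< s<k ss≢k ∷ s<k ∷ P<k ,
  λ b → trans (cong (λ c → toggle c P) (not-involutive b)) (even b)

-- The two occurrences of k in the tangled cord separate smaller from larger letters.
record Cut (m k : ℕ) : Set where
  field
    P Q U V  : List ℕ
    tc≡      : tc m ≡ P ++ k ∷ Q ++ U ++ k ∷ V
    P<k      : All (_< k) P
    Q<k      : All (_< k) Q
    U>k      : All (k <_) U
    V>k      : All (k <_) V
    -- One extra letter is counted before `P` and one before `Q`: this is the parity of the run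
    -- `b P b Q` in the swapped word.
    balanced : toggle (not (toggle true P)) Q ≡ false
    -- The second alternative says that `P` with one more letter in front, and everything after the
    -- first `k`, have even length. These are the two runs left when `a` alone is deleted.
    shape    : (k ≡ 0 × P ≡ [] × Q ≡ []) ⊎ (toggle true P ≡ false × toggle false (Q ++ U ++ k ∷ V) ≡ false)

cut : ∀ m k → k ≤ m → Cut m k
cut m zero    _   with tail-split-start 0 m
... | U , V , eq , U> , V> = record
  { P = [] ; Q = [] ; U = U ; V = V ; tc≡ = cong (0 ∷_) eq ; P<k = [] ; Q<k = [] ; U>k = U> ; V>k = V>
  ; balanced = refl ; shape = inj₁ (refl , refl , refl) }
cut m (suc _) k≤m with tail-split-later 0 m (s≤s z≤n) k≤m
... | P , j , l , refl , eq , P< , even with tail-split-start (suc j) l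
...   | U , V , eq′ , U> , V> = record
  -- The initial `0` turns the even prefix into an odd one. After the first `k` come the predecessor
  -- `j` and an odd `tail`, an even number of letters.
  { P = 0 ∷ P ; Q = j ∷ [] ; U = U ; V = V
  ; tc≡ = cong (0 ∷_) (trans eq (cong (λ t → P ++ suc j ∷ j ∷ t) eq′))
  ; P<k = s≤s z≤n ∷ P< ; Q<k = ≤-refl ∷ [] ; U>k = U> ; V>k = V>
  ; balanced = cong (not ∘ not) (even false)
  ; shape = inj₂ (even false , trans (cong (toggle true) (sym eq′)) (toggle-tail true (suc j) l)) }

-- Occurrences

occ-here : ∀ (a : Fin n) w → occ a (a ∷ w) ≡ suc (occ a w)
occ-here a w = cong length (filter-accept (a ≟_) refl)

occ-there : ∀ {a x : Fin n} w → a ≢ x → occ a (x ∷ w) ≡ occ a w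
occ-there {a = a} w a≢x = cong length (filter-reject (a ≟_) a≢x)

occ≢0⇒∈ : ∀ (a : Fin n) w → occ a w ≢ 0 → a ∈ w
occ≢0⇒∈ a []      occ≢0 = contradiction refl occ≢0
occ≢0⇒∈ a (x ∷ w) occ≢0 with a ≟ x
... | yes refl = here refl
... | no a≢x   = there (occ≢0⇒∈ a w occ≢0)

occ≡0⇒∉ : ∀ (a : Fin n) w → occ a w ≡ 0 → a ∉ w
occ≡0⇒∉ a (x ∷ w) eq (here refl) = contradiction (trans (sym (occ-here a w)) eq) λ ()
occ≡0⇒∉ a (x ∷ w) eq (there a∈w) with a ≟ x
... | yes refl = contradiction eq λ ()
... | no a≢x   = occ≡0⇒∉ a w eq a∈w

occ≡1⇒∉ : ∀ (a : Fin n) xs {ys} → occ a (xs ++ a ∷ ys) ≡ 1 → a ∉ ys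
occ≡1⇒∉ a [] {ys} eq = occ≡0⇒∉ a ys (suc-injective (trans (sym (occ-here a ys)) eq))
occ≡1⇒∉ a (x ∷ xs) eq with a ≟ x
... | yes refl = λ _ → occ≡0⇒∉ a _ (suc-injective eq) (∈-++⁺ʳ xs (here refl))
... | no a≢x   = occ≡1⇒∉ a xs eq

map-++⁻ : ∀ (f : A → C) xs ys {zs} → map f xs ≡ ys ++ zs →
  ∃₂ λ us vs → xs ≡ us ++ vs × map f us ≡ ys × map f vs ≡ zs
map-++⁻ f xs       []       eq = [] , xs , refl , refl , eq
map-++⁻ f (x ∷ xs) (y ∷ ys) eq with map-++⁻ f xs ys (∷-injectiveʳ eq)
... | us , vs , eq₁ , eq₂ , eq₃ = x ∷ us , vs , cong (x ∷_) eq₁ , cong₂ _∷_ (∷-injectiveˡ eq) eq₂ , eq₃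

-- Contracting the leading pair

merge : Fin n → Fin n → Fin n → Fin n
merge a b z = if does (z ≟ b) then a else z

merge-same : ∀ (a b : Fin n) → merge a b b ≡ a
merge-same a b rewrite dec-true (b ≟ b) refl = refl

merge-other : ∀ (a : Fin n) {b z} → z ≢ b → merge a b z ≡ z
merge-other a {b} {z} z≢b rewrite dec-false (z ≟ b) z≢b = refl

merge≡a⇒ : ∀ (a b z : Fin n) → merge a b z ≡ a → z ≡ a ⊎ z ≡ b
merge≡a⇒ a b z eq with z ≟ b
... | yes z≡b = inj₂ z≡b
... | no  _   = inj₁ eq

occ-merge-other : ∀ {a b c : Fin n} → c ≢ a → c ≢ b → ∀ w → occ c (map (merge a b) w) ≡ occ c w
occ-merge-other c≢a c≢b [] = refl
occ-merge-other {a = a} {b} {c} c≢a c≢b (x ∷ w) with x ≟ b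
... | yes refl = trans (occ-there _ c≢a) (trans (occ-merge-other c≢a c≢b w) (sym (occ-there w c≢b)))
... | no _ with c ≟ x
...   | yes _ = cong suc (occ-merge-other c≢a c≢b w)
...   | no _  = occ-merge-other c≢a c≢b w

occ-merge-a : ∀ {a b : Fin n} → a ≢ b → ∀ w → occ a (map (merge a b) w) ≡ occ a w + occ b w
occ-merge-a a≢b [] = refl
occ-merge-a {a = a} {b} a≢b (x ∷ w) with x ≟ b
... | yes refl = trans (occ-here a _) (trans (cong suc (occ-merge-a a≢b w))
                   (trans (sym (+-suc _ _)) (sym (cong₂ _+_ (occ-there w a≢b) (occ-here x w)))))
... | no x≢b with a ≟ x
...   | yes _ = cong suc (trans (occ-merge-a a≢b w) (cong (occ a w +_) (sym (occ-there w (x≢b ∘ sym)))))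
...   | no _  = trans (occ-merge-a a≢b w) (cong (occ a w +_) (sym (occ-there w (x≢b ∘ sym))))

occ-merge-b : ∀ {a b : Fin n} → a ≢ b → ∀ w → occ b (map (merge a b) w) ≡ 0
occ-merge-b a≢b [] = refl
occ-merge-b {a = a} {b} a≢b (x ∷ w) with x ≟ b
... | yes refl = trans (occ-there _ (a≢b ∘ sym)) (occ-merge-b a≢b w)
... | no x≢b   = trans (occ-there _ (x≢b ∘ sym)) (occ-merge-b a≢b w)

-- A set pulled back along `merge a b` treats `a` and `b` alike: the leading pair is deleted whole
-- or adds two letters to the first run.
merge-indecomposable : ∀ {a b : Fin n} {w} → a ≢ b → Indecomposable (a ∷ b ∷ w) → Indecomposable (map (merge a b) w)
merge-indecomposable {a = a} {b} {w} a≢b indec p x∈ px y∈ py even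
  with ∈-map⁻ (merge a b) x∈ | ∈-map⁻ (merge a b) y∈
... | _ , x∈w , refl | _ , y∈w , refl =
  indec (p ∘ merge a b) (there (there x∈w)) px (there (there y∈w)) py
    (trans skip (trans (sym (evenRuns-map (merge a b) p false w)) even))
  where
  skip : evenRuns false (p ∘ merge a b) (a ∷ b ∷ w) ≡ evenRuns false (p ∘ merge a b) w
  skip rewrite merge-other a a≢b | merge-same a b with p a
  ... | true  = refl
  ... | false = refl

DoublyOccurring : List (Fin n) → Set
DoublyOccurring w = ∀ a → occ a w ≡ 0 ⊎ occ a w ≡ 2

occ-tail : ∀ {a : Fin n} {w} → DoublyOccurring (a ∷ w) → occ a w ≡ 1
occ-tail {a = a} {w} dbl with dbl a
... | inj₁ eq = contradiction (trans (sym (occ-here a w)) eq) λ ()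
... | inj₂ eq = suc-injective (trans (sym (occ-here a w)) eq)

merge-doublyOccurring : ∀ {a b : Fin n} {w} → a ≢ b → occ a w ≡ 1 → occ b w ≡ 1 →
  DoublyOccurring (a ∷ b ∷ w) → DoublyOccurring (map (merge a b) w)
merge-doublyOccurring {a = a} {b} {w} a≢b occa occb dbl c with c ≟ a | c ≟ b
... | yes refl | _        = inj₂ (trans (occ-merge-a a≢b w) (cong₂ _+_ occa occb))
... | no _     | yes refl = inj₁ (occ-merge-b a≢b w)
... | no c≢a   | no c≢b   rewrite occ-merge-other c≢a c≢b w
                                | sym (trans (occ-there {a = c} {x = a} (b ∷ w) c≢a) (occ-there w c≢b)) = dbl c

-- A renaming that need only be invertible on the letters of `w`. A permutation of `Fin n` would be
-- too much to ask during the induction, since contracted words leave letters of the alphabet out.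
record Labelling (m : ℕ) (w : List (Fin n)) : Set where
  field
    label   : Fin n → ℕ
    letter  : ℕ → Fin n
    spells  : map label w ≡ tc m
    inverse : ∀ {z} → z ∈ w → letter (label z) ≡ z

map-∷⁻ : ∀ (f : A → C) xs {y ys} → map f xs ≡ y ∷ ys →
  ∃₂ λ x xs′ → xs ≡ x ∷ xs′ × f x ≡ y × map f xs′ ≡ ys
map-∷⁻ f (x ∷ xs) eq = x , xs , refl , ∷-injectiveˡ eq , ∷-injectiveʳ eq

map-≡[] : ∀ {f : A → C} xs → map f xs ≡ [] → xs ≡ []
map-≡[] [] _ = refl

map-suc-tail : ∀ k l → map suc (tail k l) ≡ tail (suc k) l
map-suc-tail k zero    = refl
map-suc-tail k (suc l) = cong (λ t → suc (suc k) ∷ suc k ∷ t) (map-suc-tail (suc k) l)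

-- Three shapes of decomposable words

swapped-decomposable : ∀ {a b : Fin n} (φ : Fin n → ℕ) {p q u v} → a ≢ b →
  All (λ z → φ z < φ a) p → All (λ z → φ z < φ a) q → All (λ z → φ a < φ z) u → All (λ z → φ a < φ z) v →
  φ b ≡ φ a → toggle (not (toggle true p)) q ≡ false →
  ¬ Indecomposable (a ∷ b ∷ p ++ b ∷ q ++ u ++ a ∷ v)
swapped-decomposable {a = a} {b} φ {p} {q} {u} {v} a≢b p<k q<k u>k v>k φb balanced indec =
  indec σ (here refl) σa (there (here refl)) σb even
  where
  σ : Fin _ → Bool
  -- The labels of `a` and `b` coincide, so `a` is picked out as a letter, while the strict
  -- comparison keeps `b` outside.
  σ z = does (z ≟ a) ∨ does (φ a <? φ z)
  σa : σ a ≡ true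
  σa rewrite dec-true (a ≟ a) refl = refl
  σ-above : ∀ {z} → φ a < φ z → σ z ≡ true
  σ-above {z} lt rewrite dec-true (φ a <? φ z) lt = ∨-zeroʳ _
  σ-out : ∀ {z} → z ≢ a → ¬ φ a < φ z → σ z ≡ false
  σ-out {z} z≢a ≮ rewrite dec-false (z ≟ a) z≢a | dec-false (φ a <? φ z) ≮ = refl
  σb : σ b ≡ false
  σb = σ-out (a≢b ∘ sym) (<-irrefl (sym φb))
  σ-below : ∀ {z} → φ z < φ a → σ z ≡ false
  σ-below lt = σ-out (λ { refl → <-irrefl refl lt }) (<-asym lt)
  even : evenRuns false σ (a ∷ b ∷ p ++ b ∷ q ++ u ++ a ∷ v) ≡ true
  even = begin
    evenRuns false σ (a ∷ b ∷ p ++ b ∷ q ++ u ++ a ∷ v)             ≡⟨ evenRuns-∷-in σ a (b ∷ p ++ b ∷ q ++ u ++ a ∷ v) σa ⟩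
    evenRuns false σ ((b ∷ p) ++ (b ∷ q) ++ u ++ a ∷ v)              ≡⟨ evenRuns-++-out σ false (b ∷ p) (σb ∷ All.map σ-below p<k) ⟩
    evenRuns (toggle true p) σ ((b ∷ q) ++ u ++ a ∷ v)               ≡⟨ evenRuns-++-out σ (toggle true p) (b ∷ q) (σb ∷ All.map σ-below q<k) ⟩
    evenRuns (toggle (not (toggle true p)) q) σ (u ++ a ∷ v)         ≡⟨ cong (λ c → evenRuns c σ (u ++ a ∷ v)) balanced ⟩
    evenRuns false σ (u ++ a ∷ v)                                    ≡⟨ evenRuns-in σ (++⁺ (All.map σ-above u>k) (σa ∷ All.map σ-above v>k)) ⟩
    true                                                             ∎
    where open ≡-Reasoning

-- Deleting `a` alone leaves the runs `b ∷ p` and `r`; the flag `true` before `p` accounts for `b`.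
isolated-decomposable : ∀ {a b : Fin n} {p r} → b ≢ a → All (_≢ a) p → All (_≢ a) r →
  toggle true p ≡ false → toggle false r ≡ false → ¬ Indecomposable (a ∷ b ∷ p ++ a ∷ r)
isolated-decomposable {a = a} {b} {p} {r} b≢a p≢a r≢a p-odd r-even indec =
  indec σ (here refl) σa (there (here refl)) (σ-out b≢a) even
  where
  σ : Fin _ → Bool
  σ z = does (z ≟ a)
  σa : σ a ≡ true
  σa = dec-true (a ≟ a) refl
  σ-out : ∀ {z} → z ≢ a → σ z ≡ false
  σ-out {z} = dec-false (z ≟ a)
  even : evenRuns false σ (a ∷ b ∷ p ++ a ∷ r) ≡ true
  even = begin
    evenRuns false σ (a ∷ b ∷ p ++ a ∷ r)      ≡⟨ evenRuns-∷-in σ a (b ∷ p ++ a ∷ r) σa ⟩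
    evenRuns false σ ((b ∷ p) ++ a ∷ r)        ≡⟨ evenRuns-++-out σ false (b ∷ p) (σ-out b≢a ∷ All.map σ-out p≢a) ⟩
    evenRuns (toggle true p) σ (a ∷ r)         ≡⟨ cong (λ c → evenRuns c σ (a ∷ r)) p-odd ⟩
    evenRuns false σ (a ∷ r)                   ≡⟨ evenRuns-∷-in σ a r σa ⟩
    evenRuns false σ r                         ≡⟨ evenRuns-out σ false (All.map σ-out r≢a) ⟩
    not (toggle false r)                       ≡⟨ cong not r-even ⟩
    true                                       ∎
    where open ≡-Reasoning

-- Deleting every letter except `a` leaves the single block `a a`; `c` shows that something is
-- deleted.
square-decomposable : ∀ {a c : Fin n} {w} → c ∈ w → a ∉ w → ¬ Indecomposable (a ∷ a ∷ w)
square-decomposable {a = a} {c} {w} c∈w a∉w indec =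
  indec σ (there (there c∈w)) (All.lookup w-in c∈w) (here refl) σa even
  where
  σ : Fin _ → Bool
  σ z = not (does (z ≟ a))
  σa : σ a ≡ false
  σa = cong not (dec-true (a ≟ a) refl)
  w-in : All (λ z → σ z ≡ true) w
  w-in = All.tabulate λ {z} z∈w → cong not (dec-false (z ≟ a) λ { refl → a∉w z∈w })
  even : evenRuns false σ (a ∷ a ∷ w) ≡ true
  even = trans (evenRuns-++-out σ false (a ∷ a ∷ []) {w} (σa ∷ σa ∷ [])) (evenRuns-in σ w-in)

-- Lifting a labelling through the contraction

module _ {a b : Fin n} {w : List (Fin n)} {m : ℕ} (a≢b : a ≢ b)
  (L : Labelling m (map (merge a b) w)) (a∈w : a ∈ w) where

  open Labelling L

  -- Labels of the contracted word read on `w` itself. The common value at `a` and `b` is the letter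
  -- `k` of the tangled cord that the contraction produced.
  φ : Fin n → ℕ
  φ = label ∘ merge a b

  φa≡ : φ a ≡ label a
  φa≡ = cong label (merge-other a a≢b)

  φb≡φa : φ b ≡ φ a
  φb≡φa = trans (cong label (merge-same a b)) (sym φa≡)

  spells-φ : map φ w ≡ tc m
  spells-φ = trans (map-∘ w) spells

  letter-φ : ∀ {z} → z ∈ w → letter (φ z) ≡ merge a b z
  letter-φ z∈w = inverse (∈-map⁺ (merge a b) z∈w)

  φa≤m : φ a ≤ m
  φa≤m = All.lookup (tc-≤ m) (subst (φ a ∈_) spells-φ (∈-map⁺ φ a∈w))

  -- Equal labels mean equal letters after merging, and only `a` and `b` merge to `a`. This
  -- identifies the letters of `w` at the two places of `k`.
  φ≡φa⇒ : ∀ {z} → z ∈ w → φ z ≡ φ a → z ≡ a ⊎ z ≡ b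
  φ≡φa⇒ {z} z∈w eq = merge≡a⇒ a b z (trans (sym (letter-φ z∈w))
    (trans (cong letter eq) (trans (letter-φ a∈w) (merge-other a a≢b))))

  -- Meant for `φ a ≡ 0`: `a` becomes the new first letter and all other labels move up by one, so
  -- `b` gets `1`.
  label′ : Fin n → ℕ
  label′ z = if does (z ≟ a) then 0 else suc (φ z)

  label′-a : label′ a ≡ 0
  label′-a rewrite dec-true (a ≟ a) refl = refl

  label′-other : ∀ {z} → z ≢ a → label′ z ≡ suc (φ z)
  label′-other {z} z≢a rewrite dec-false (z ≟ a) z≢a = refl

  letter′ : ℕ → Fin n
  letter′ 0             = a
  -- When `φ a` is `0`, `letter 0` is the merged letter `a`, so the shifted label `1` must be sent
  -- to `b` explicitly.
  letter′ 1             = b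
  letter′ (suc (suc j)) = letter (suc j)

  letter′-suc : φ a ≡ 0 → ∀ {z} → z ∈ w → z ≢ a → z ≢ b → ∀ j → φ z ≡ j → letter′ (suc j) ≡ z
  letter′-suc φa≡0 z∈w z≢a z≢b zero eq with φ≡φa⇒ z∈w (trans eq (sym φa≡0))
  ... | inj₁ z≡a = contradiction z≡a z≢a
  ... | inj₂ z≡b = contradiction z≡b z≢b
  letter′-suc φa≡0 z∈w z≢a z≢b (suc j) eq = trans (cong letter (sym eq)) (trans (letter-φ z∈w) (merge-other a z≢b))

  inverse′-a : letter′ (label′ a) ≡ a
  inverse′-a = cong letter′ label′-a

  inverse′-b : φ a ≡ 0 → letter′ (label′ b) ≡ b
  inverse′-b φa≡0 = cong letter′ (trans (label′-other (a≢b ∘ sym)) (cong suc (trans φb≡φa φa≡0)))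

  inverse′ : φ a ≡ 0 → ∀ {z} → z ∈ a ∷ b ∷ w → letter′ (label′ z) ≡ z
  inverse′ φa≡0 (here refl)         = inverse′-a
  inverse′ φa≡0 (there (here refl)) = inverse′-b φa≡0
  inverse′ φa≡0 {z} (there (there z∈w)) = by-cases (z ≟ a) (z ≟ b)
    where
    by-cases : Dec (z ≡ a) → Dec (z ≡ b) → letter′ (label′ z) ≡ z
    by-cases (yes refl) _          = inverse′-a
    by-cases (no _)     (yes refl) = inverse′-b φa≡0
    by-cases (no z≢a)   (no z≢b)   =
      trans (cong letter′ (label′-other z≢a)) (letter′-suc φa≡0 z∈w z≢a z≢b (φ z) refl)

  -- In `a b a r` the first three letters spell `0 1 0`, and `r` spells `tail 0 m` raised by one;
  -- together this is `tc (suc m)`.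
  extend : ∀ {r} → w ≡ a ∷ r → All (_≢ a) r → φ a ≡ 0 → Labelling (suc m) (a ∷ b ∷ w)
  extend {r} refl r≢a φa≡0 = record
    { label = label′ ; letter = letter′ ; inverse = inverse′ φa≡0
    ; spells = cong₂ _∷_ label′-a (cong₂ _∷_ (trans (label′-other (a≢b ∘ sym)) (cong suc (trans φb≡φa φa≡0)))
        (cong₂ _∷_ label′-a rest)) }
    where
    rest : map label′ r ≡ tail 1 m
    rest = begin
      map label′ r           ≡⟨ map-cong-local (All.map label′-other r≢a) ⟩
      map (suc ∘ φ) r        ≡⟨ map-∘ r ⟩
      map suc (map φ r)      ≡⟨ cong (map suc) (∷-injectiveʳ spells-φ) ⟩
      map suc (tail 0 m)     ≡⟨ map-suc-tail 0 m ⟩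
      tail 1 m               ∎
      where open ≡-Reasoning

  expand : occ a w ≡ 1 → occ b w ≡ 1 → Indecomposable (a ∷ b ∷ w) → Labelling (suc m) (a ∷ b ∷ w)
  expand occa occb indec = go
    where
    open Cut (cut m (φ a) φa≤m)
    below≢a : ∀ {z} → φ z < φ a → z ≢ a
    below≢a lt refl = <-irrefl refl lt
    above≢a : ∀ {z} → φ a < φ z → z ≢ a
    above≢a lt refl = <-irrefl refl lt
    go : Labelling (suc m) (a ∷ b ∷ w)
    -- The cut of the tangled cord at `φ a` is carried back to `w`, which becomes `p x q u y v` with
    -- `x` and `y` each equal to `a` or `b`.
    go with map-++⁻ φ w P (trans spells-φ tc≡)
    ... | p , _ , w≡ , p↦ , eq₁ with map-∷⁻ φ _ eq₁
    ... | x , _ , refl , x↦ , eq₂ with map-++⁻ φ _ Q eq₂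
    ... | q , _ , refl , q↦ , eq₃ with map-++⁻ φ _ U eq₃
    ... | u , _ , refl , u↦ , eq₄ with map-∷⁻ φ _ eq₄
    ... | y , v , refl , y↦ , v↦ = cases (φ≡φa⇒ x∈w x↦) (φ≡φa⇒ y∈w y↦)
      where
      later = q ++ u ++ y ∷ v
      y∈later : y ∈ later
      y∈later = ∈-++⁺ʳ q (∈-++⁺ʳ u (here refl))
      x∈w : x ∈ w
      x∈w = subst (x ∈_) (sym w≡) (∈-++⁺ʳ p (here refl))
      y∈w : y ∈ w
      y∈w = subst (y ∈_) (sym w≡) (∈-++⁺ʳ p (there y∈later))
      pull : ∀ {R : ℕ → Set} {xs ys} → map φ xs ≡ ys → All R ys → All (R ∘ φ) xs
      pull refl = map⁻
      toggle-pull : ∀ {xs ys} → map φ xs ≡ ys → ∀ c → toggle c ys ≡ toggle c xs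
      toggle-pull {xs} refl c = toggle-map φ c xs
      cases : x ≡ a ⊎ x ≡ b → y ≡ a ⊎ y ≡ b → Labelling (suc m) (a ∷ b ∷ w)
      -- Equal letters at both places contradict the single occurrence of `a` or of `b` in `w`.
      cases (inj₁ refl) (inj₁ refl) = contradiction y∈later (occ≡1⇒∉ a p (trans (cong (occ a) (sym w≡)) occa))
      cases (inj₂ refl) (inj₂ refl) = contradiction y∈later (occ≡1⇒∉ b p (trans (cong (occ b) (sym w≡)) occb))
      cases (inj₂ refl) (inj₁ refl) = contradiction (subst (λ t → Indecomposable (a ∷ b ∷ t)) w≡ indec)
        (swapped-decomposable φ a≢b (pull p↦ P<k) (pull q↦ Q<k) (pull u↦ U>k) (pull v↦ V>k) φb≡φa
          (trans (sym (trans (toggle-pull q↦ _) (cong (λ c → toggle (not c) q) (toggle-pull p↦ true)))) balanced))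
      cases (inj₁ refl) (inj₂ refl) = straight shape
        where
        later≢a : All (_≢ a) later
        later≢a = ++⁺ (All.map below≢a (pull q↦ Q<k))
          (++⁺ (All.map above≢a (pull u↦ U>k)) (a≢b ∘ sym ∷ All.map above≢a (pull v↦ V>k)))
        straight : _ → Labelling (suc m) (a ∷ b ∷ w)
        straight (inj₂ (P-odd , rest-even)) = contradiction (subst (λ t → Indecomposable (a ∷ b ∷ t)) w≡ indec)
          (isolated-decomposable (a≢b ∘ sym) (All.map below≢a (pull p↦ P<k)) later≢a
            (trans (sym (toggle-pull p↦ true)) P-odd) (trans (sym (toggle-pull eq₂ false)) rest-even))
        -- Since `P` is empty, `w` starts with `a`, and the word has the form `a b a r`.
        straight (inj₁ (φa≡0 , P≡[] , _)) = extend (trans w≡ (cong (_++ a ∷ later) (map-≡[] p (trans p↦ P≡[])))) later≢a φa≡0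

-- Induction on the number of letters

labelling : ∀ m (w : List (Fin n)) → DoublyOccurring w → length w ≡ 2 * suc m → Indecomposable w → Labelling m w
labelling zero (a ∷ b ∷ []) dbl _ _ with occ≢0⇒∈ a (b ∷ []) (λ eq → contradiction (trans (sym eq) (occ-tail dbl)) λ ())
... | here refl = record { label = const 0 ; letter = const a ; spells = refl
                         ; inverse = λ { (here refl) → refl ; (there (here refl)) → refl } }
labelling (suc m) (a ∷ []) _ len _ = contradiction (suc-injective (trans len (*-suc 2 (suc m)))) λ ()
labelling (suc m) (a ∷ b ∷ []) _ len _ = contradiction (suc-injective (suc-injective (trans len (*-suc 2 (suc m))))) λ ()
labelling (suc m) (a ∷ b ∷ w@(c ∷ _)) dbl len indec with a ≟ b
-- Both occurrences of `a` are used up by the leading square, so `c` is a different letter.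
... | yes refl = contradiction indec
  (square-decomposable (here refl) (occ≡1⇒∉ a [] (occ-tail dbl)))
... | no a≢b = expand a≢b ih a∈w occa occb indec
  where
  occa : occ a w ≡ 1
  occa = trans (sym (occ-there w a≢b)) (occ-tail dbl)
  occb : occ b w ≡ 1
  occb with dbl b
  ... | inj₁ eq = contradiction (there (here refl)) (occ≡0⇒∉ b (a ∷ b ∷ w) eq)
  ... | inj₂ eq = suc-injective (trans (sym (trans (occ-there (b ∷ w) (a≢b ∘ sym)) (occ-here b w))) eq)
  a∈w : a ∈ w
  a∈w = occ≢0⇒∈ a w λ eq → contradiction (trans (sym eq) occa) λ ()
  -- The letter `b` leaves the word but not the alphabet, so `m` decreases while `n` stays fixed.
  ih : Labelling m (map (merge a b) w)
  ih = labelling m (map (merge a b) w) (merge-doublyOccurring a≢b occa occb dbl)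
    (trans (length-map _ w) (suc-injective (suc-injective (trans len (*-suc 2 (suc m))))))
    (merge-indecomposable a≢b indec)

-- From labellings to permutations

injective⇒surjective : ∀ (f : Fin n → Fin n) → (∀ {i j} → f i ≡ f j → i ≡ j) → ∀ y → ∃ λ x → f x ≡ y
injective⇒surjective {suc n} f inj y with Finₚ.any? (λ x → f x ≟ y)
... | yes found   = found
-- Pigeonhole: if `y` is missed, punching it out turns `f` into an injection from `Fin (suc n)` to
-- `Fin n`.
... | no notFound = contradiction (Finₚ.injective⇒≤ {f = λ x → punchOut (avoid x)}
        (λ eq → inj (Finₚ.punchOut-injective (avoid _) (avoid _) eq))) (<-irrefl refl)
  where
  avoid : ∀ x → y ≢ f x
  avoid x y≡fx = notFound (x , sym y≡fx)

labelling⇒renaming : ∀ {m} {w : List (Fin (suc m))} → Labelling m w → IsTCUpToRenaming w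
labelling⇒renaming {m} {w} L = permutation to from to-from from-to , trans spells′ (sym (tcℕ≡tc m))
  where
  open Labelling L
  from : Fin (suc m) → Fin (suc m)
  from = letter ∘ toℕ
  -- Every number up to `m` occurs in the tangled cord, so it is the label of a letter of `w`, where
  -- `letter` undoes `label`. Hence `from` is injective, and by finiteness bijective.
  label-from : ∀ j → label (from j) ≡ toℕ j
  label-from j with ∈-map⁻ label (subst (toℕ j ∈_) (sym spells) (∈-tc m (Finₚ.toℕ≤pred[n] j)))
  ... | z , z∈w , eq = trans (cong (label ∘ letter) eq) (trans (cong label (inverse z∈w)) (sym eq))
  from-surjective : ∀ x → ∃ λ j → from j ≡ x
  from-surjective = injective⇒surjective from λ {i} {j} eq →
    Finₚ.toℕ-injective (trans (sym (label-from i)) (trans (cong label eq) (label-from j)))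
  to : Fin (suc m) → Fin (suc m)
  to x = proj₁ (from-surjective x)
  from-to : ∀ x → from (to x) ≡ x
  from-to x = proj₂ (from-surjective x)
  toℕ-to : ∀ x → toℕ (to x) ≡ label x
  toℕ-to x = trans (sym (label-from (to x))) (cong label (from-to x))
  to-from : ∀ j → to (from j) ≡ j
  to-from j = Finₚ.toℕ-injective (trans (toℕ-to (from j)) (label-from j))
  spells′ : map (toℕ ∘ to) w ≡ tc m
  spells′ = trans (map-cong toℕ-to w) spells

-- Odd blocks in renamed tangled cords

renaming⇒oddBlocks : ∀ {m} {w : List (Fin (suc m))} → IsTCUpToRenaming w →
  ∀ σ → Nonempty σ → σ ⊂ ⊤ → Any OddLength (w ∖ σ)
renaming⇒oddBlocks {m} {w} (π , spells) σ (x , x∈σ) (_ , y , _ , y∉σ) = ¬allEven⇒anyOdd (w ∖ σ) (¬-not notEven)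
  where
  p : ℕ → Bool
  p j with j <? suc m
  ... | yes j<n = does (π ⟨$⟩ˡ fromℕ< j<n ∈? σ)
  -- A default for numbers above `m`, which are not labels of letters.
  ... | no _    = false
  p-label : ∀ z → p (toℕ (π ⟨$⟩ʳ z)) ≡ does (z ∈? σ)
  p-label z with toℕ (π ⟨$⟩ʳ z) <? suc m
  ... | yes lt = cong (λ t → does (t ∈? σ)) (trans (cong (π ⟨$⟩ˡ_) (Finₚ.fromℕ<-toℕ _ lt)) (inverseˡ π))
  ... | no ≮   = contradiction (Finₚ.toℕ<n (π ⟨$⟩ʳ z)) ≮
  label∈ : ∀ z → toℕ (π ⟨$⟩ʳ z) ∈ tc m
  label∈ z = ∈-tc m (Finₚ.toℕ≤pred[n] (π ⟨$⟩ʳ z))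
  notEven : allEven (w ∖ σ) ≢ true
  notEven even = tc-indecomposable m p
    (label∈ x) (trans (p-label x) (dec-true (x ∈? σ) x∈σ))
    (label∈ y) (trans (p-label y) (dec-false (y ∈? σ) y∉σ))
    (begin
      evenRuns false p (tc m)                                  ≡⟨ cong (evenRuns false p) (sym (trans spells (tcℕ≡tc m))) ⟩
      evenRuns false p (map (λ z → toℕ (π ⟨$⟩ʳ z)) w)          ≡⟨ evenRuns-map _ p false w ⟩
      evenRuns false (λ z → p (toℕ (π ⟨$⟩ʳ z))) w              ≡⟨ evenRuns-cong p-label false w ⟩
      evenRuns false (λ z → does (z ∈? σ)) w                   ≡⟨ evenRuns-∖ σ w ⟩
      allEven (w ∖ σ)                                          ≡⟨ even ⟩
      true                                                     ∎)
    where open ≡-Reasoning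

theorem4p7 : (m : ℕ) (w : List (Fin (suc m))) → DoubleOccurrence w → length w ≡ 2 * suc m →
    ((∀ (σ : Subset (suc m)) → Nonempty σ → σ ⊂ ⊤ → Any OddLength (w ∖ σ)) ⇔ IsTCUpToRenaming w)
theorem4p7 m w (_ , dbl) len = mk⇔
  (λ odd → labelling⇒renaming (labelling m w dbl len (oddBlocks⇒indecomposable odd)))
  renaming⇒oddBlocks
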